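{- Let $p$ be any prime, and let $n$, $m$, $s$ and $r$ be nonnegative integers such that $n\ge m$, $s\ge 1$, $1\le r\le p^s-1$ and $r$ is not divisible by $p$. Then \[ \binom{np^s}{mp^s+r}\equiv (-1)^{r-1}\, r^{ -1}\,(m+1)\binom{n}{m+1}\,p^s \pmod{p^{s+1}}, \] where $r^{ -1}$ denotes any integer $r'$ with $rr'\equiv 1 \pmod p$ (the inverse of $r$ modulo $p$).
   Context: Binomial coefficients follow the convention $\binom{l}{t}=0$ if $l<t$ and $\binom{0}{0}=1$. Since the right-hand side carries the factor $p^s$, the congruence modulo $p^{s+1}$ does not depend on the choice of the integer representative of $r^{ -1}$ modulo $p$. -}

module Defs where

open import Data.Integer.Base using (ℤ; _-_)
open import Data.Integer.Divisibility.Signed using (_∣_)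

infix 4 _≡_[mod_]

_≡_[mod_] : ℤ → ℤ → ℤ → Set
a ≡ b [mod k ] = k ∣ (a - b)

{-# OPTIONS --safe #-}

-- Write q = p ^ s, N = n q and k = m q + r.  Absorption gives
-- k * C(N , k) = N * C(N - 1 , k - 1).  As p ∤ k, this forces q ∣ C(N , k), so that
-- modulo p q the left side is r * C(N , k).  On the right, N carries the factor q,
-- so C(N - 1 , k - 1) matters only modulo p, where Lucas' congruence for the base q
-- gives C(n - 1 , m) * C(q - 1 , r - 1) ≡ C(n - 1 , m) * (-1) ^ (r - 1).  A second
-- absorption, n * C(n - 1 , m) = (m + 1) * C(n , m + 1), finishes the proof.

module Submission where

open import Defs
open import Data.Nat.Base as ℕ using (ℕ; _≤_; _≥_; _∸_)
open import Data.Nat.Base using (zero; suc; _<_; s≤s; z<s; s<s)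
open import Data.Nat.Combinatorics using (_C_)
open import Data.Nat.Combinatorics using (nCk+nC[k+1]≡[n+1]C[k+1]; k>n⇒nCk≡0; nCn≡1; nC1≡n)
open import Data.Nat.Divisibility using (_∤_)
open import Data.Nat.Primality using (Prime)
open import Data.Nat.Primality using (euclidsLemma; prime⇒nonZero)
open import Data.Integer.Base using (ℤ; +_; -1ℤ; 1ℤ; _*_; _^_)
open import Data.Integer.Base using (0ℤ; _+_; _-_; -_)
open import Data.Integer.Divisibility.Signed using (divides)
open import Data.Integer.Tactic.RingSolver using (solve-∀)
open import Data.Sum.Base using (inj₁; inj₂)
open import Relation.Binary.Bundles using (Setoid)
open import Relation.Binary.PropositionalEquality
open import Relation.Nullary using (yes; no; contradiction)
import Data.Integer.Divisibility.Signed as ℤ∣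
import Data.Integer.Properties as ℤ
import Data.Nat.Divisibility as ℕ∣
import Data.Nat.Properties as ℕ
import Data.Nat.Tactic.RingSolver as ℕSolver
import Relation.Binary.Reasoning.Setoid as SetoidReasoning

-- Absorption and divisibility by prime powers.

-- Induction through Pascal's rule, free of factorials and division: splitting k + 2 as (k + 1) + 1
-- leaves one spare copy of `x`, which at the end raises the factor n + 1 to n + 2.
absorption : ∀ n k → suc k ℕ.* (suc n C suc k) ≡ suc n ℕ.* (n C k)
absorption n zero = begin
  1 ℕ.* (suc n C 1)          ≡⟨ ℕ.*-identityˡ _ ⟩
  suc n C 1                  ≡⟨ nC1≡n (suc n) ⟩
  suc n                      ≡⟨ ℕ.*-identityʳ (suc n) ⟨
  suc n ℕ.* (n C 0)          ∎
  where open ≡-Reasoning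
absorption zero (suc k) = begin
  suc (suc k) ℕ.* (1 C suc (suc k))  ≡⟨ cong (suc (suc k) ℕ.*_) (k>n⇒nCk≡0 {1} {suc (suc k)} (s<s z<s)) ⟩
  suc (suc k) ℕ.* 0                  ≡⟨ ℕ.*-zeroʳ (suc (suc k)) ⟩
  0                                  ≡⟨ cong (1 ℕ.*_) (k>n⇒nCk≡0 {0} {suc k} z<s) ⟨
  1 ℕ.* (0 C suc k)                  ∎
  where open ≡-Reasoning
absorption (suc n) (suc k) = begin
  suc (suc k) ℕ.* (suc (suc n) C suc (suc k))
    ≡⟨ cong (suc (suc k) ℕ.*_) (nCk+nC[k+1]≡[n+1]C[k+1] (suc n) (suc k)) ⟨
  suc (suc k) ℕ.* (x ℕ.+ y)
    ≡⟨ expand (suc k) x y ⟩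
  suc k ℕ.* x ℕ.+ suc (suc k) ℕ.* y ℕ.+ x
    ≡⟨ cong (ℕ._+ x) (cong₂ ℕ._+_ (absorption n k) (absorption n (suc k))) ⟩
  suc n ℕ.* (n C k) ℕ.+ suc n ℕ.* (n C suc k) ℕ.+ x
    ≡⟨ cong (ℕ._+ x) (ℕ.*-distribˡ-+ (suc n) (n C k) (n C suc k)) ⟨
  suc n ℕ.* (n C k ℕ.+ n C suc k) ℕ.+ x
    ≡⟨ cong (λ z → suc n ℕ.* z ℕ.+ x) (nCk+nC[k+1]≡[n+1]C[k+1] n k) ⟩
  suc n ℕ.* x ℕ.+ x
    ≡⟨ ℕ.+-comm (suc n ℕ.* x) x ⟩
  suc (suc n) ℕ.* x ∎
  where
  open ≡-Reasoning
  x = suc n C suc k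
  y = suc n C suc (suc k)
  expand : ∀ a x y → suc a ℕ.* (x ℕ.+ y) ≡ a ℕ.* x ℕ.+ suc a ℕ.* y ℕ.+ x
  expand = ℕSolver.solve-∀

-- Euclid's lemma finds one factor p in `n`; cancelling it on both sides lowers the exponent.
p^s∣m*n⇒p^s∣n : ∀ {p} s {m n} → Prime p → p ∤ m → p ℕ.^ s ℕ∣.∣ m ℕ.* n → p ℕ.^ s ℕ∣.∣ n
p^s∣m*n⇒p^s∣n zero _ _ _ = ℕ∣.1∣ _
p^s∣m*n⇒p^s∣n {p} (suc s) {m} {n} pr p∤m d
  with euclidsLemma m n pr (ℕ∣.∣-trans (ℕ∣.m∣m*n (p ℕ.^ s)) d)
... | inj₁ p∣m = contradiction p∣m p∤m
... | inj₂ (ℕ∣.divides t refl) =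
  subst (p ℕ.* p ℕ.^ s ℕ∣.∣_) (ℕ.*-comm p t)
    (ℕ∣.*-monoʳ-∣ p (p^s∣m*n⇒p^s∣n s pr p∤m
      (ℕ∣.*-cancelˡ-∣ p (subst (p ℕ.* p ℕ.^ s ℕ∣.∣_) (rearrange m t p) d))))
  where
  instance _ = prime⇒nonZero pr
  rearrange : ∀ m t p → m ℕ.* (t ℕ.* p) ≡ p ℕ.* (m ℕ.* t)
  rearrange = ℕSolver.solve-∀

-- Absorption makes q = p ^ s divide C(q , k + 1) * (k + 1). Were the binomial prime to p, all of q
-- would divide k + 1, which lies strictly between 0 and q.
p∣p^sCk : ∀ {p} s {k} → Prime p → suc k < p ℕ.^ s → p ℕ∣.∣ (p ℕ.^ s C suc k)
p∣p^sCk {p} s {k} pr k<q with p ℕ∣.∣? (p ℕ.^ s C suc k)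
... | yes p∣c = p∣c
... | no  p∤c = contradiction (ℕ∣.∣⇒≤ (p^s∣m*n⇒p^s∣n s pr p∤c (q∣c*k (p ℕ.^ s) k<q))) (ℕ.<⇒≱ k<q)
  where
  q∣c*k : ∀ q → suc k < q → q ℕ∣.∣ (q C suc k) ℕ.* suc k
  q∣c*k (suc q) _ = subst (suc q ℕ∣.∣_)
    (trans (sym (absorption q k)) (ℕ.*-comm (suc k) _)) (ℕ∣.m∣m*n (q C k))

-- Congruence modulo an integer.

module Congruence (k : ℤ) where

  -- Unlike the unfolding of a ≡ b [mod k ], the record lets a and b be inferred.
  infix 4 _≋_
  record _≋_ (a b : ℤ) : Set where
    constructor mod
    field unmod : a ≡ b [mod k ]
  open _≋_ public

  ≋-reflexive : ∀ {a b} → a ≡ b → a ≋ b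
  ≋-reflexive {a} refl = mod (divides 0ℤ (ℤ.+-inverseʳ a))

  ≋-refl : ∀ {a} → a ≋ a
  ≋-refl = ≋-reflexive refl

  ≋-sym : ∀ {a b} → a ≋ b → b ≋ a
  ≋-sym {a} {b} (mod d) = mod (subst (k ℤ∣.∣_) (flip a b) (ℤ∣.∣m⇒∣-m d))
    where
    flip : ∀ a b → - (a - b) ≡ b - a
    flip = solve-∀

  ≋-trans : ∀ {a b c} → a ≋ b → b ≋ c → a ≋ c
  ≋-trans {a} {b} {c} (mod d) (mod e) = mod (subst (k ℤ∣.∣_) (telescope a b c) (ℤ∣.∣m∣n⇒∣m+n d e))
    where
    telescope : ∀ a b c → (a - b) + (b - c) ≡ a - c
    telescope = solve-∀

  ≋-setoid : Setoid _ _
  ≋-setoid = record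
    { _≈_ = _≋_
    ; isEquivalence = record { refl = ≋-refl ; sym = ≋-sym ; trans = ≋-trans }
    }

  +-cong : ∀ {a b c d} → a ≋ b → c ≋ d → a + c ≋ b + d
  +-cong {a} {b} {c} {d} (mod x) (mod y) = mod (subst (k ℤ∣.∣_) (regroup a b c d) (ℤ∣.∣m∣n⇒∣m+n x y))
    where
    regroup : ∀ a b c d → (a - b) + (c - d) ≡ (a + c) - (b + d)
    regroup = solve-∀

  *-congˡ : ∀ c {a b} → a ≋ b → c * a ≋ c * b
  *-congˡ c {a} {b} (mod x) = mod (subst (k ℤ∣.∣_) (distrib c a b) (ℤ∣.∣n⇒∣m*n c x))
    where
    distrib : ∀ c a b → c * (a - b) ≡ c * a - c * b
    distrib = solve-∀

  ∣⇒≋0 : ∀ {a} → k ℤ∣.∣ a → a ≋ 0ℤ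
  ∣⇒≋0 {a} d = mod (subst (k ℤ∣.∣_) (sym (ℤ.+-identityʳ a)) d)

-- The modulus grows with the two sides; this lifts a congruence modulo p to one modulo p q.
*-mono-mod : ∀ {k a b} c → Congruence._≋_ k a b → a * c ≡ b * c [mod k * c ]
*-mono-mod {k} {a} {b} c (Congruence.mod d) = subst (k * c ℤ∣.∣_) (distrib a b c) (ℤ∣.*-monoˡ-∣ c {k} {a - b} d)
  where
  distrib : ∀ a b c → (a - b) * c ≡ a * c - b * c
  distrib = solve-∀

-- Lucas' congruence in base q.

+-pascal : ∀ n k → + (suc n C suc k) ≡ + (n C k) + + (n C suc k)
+-pascal n k = cong +_ (sym (nCk+nC[k+1]≡[n+1]C[k+1] n k))

-- Bases q = p ^ s enter Lucas' congruence only through p ∣ C(q , k) for 0 < k < q.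
module Lucas (p Q : ℕ) (p∣qCk : ∀ k → suc k < suc Q → p ℕ∣.∣ (suc Q C suc k)) where

  private
    q = suc Q

  open Congruence (+ p)
  open SetoidReasoning ≋-setoid

  qCk≋0 : ∀ k → suc k < q → + (q C suc k) ≋ 0ℤ
  qCk≋0 k k<q = ∣⇒≋0 (ℤ∣.∣ᵤ⇒∣ (p∣qCk k k<q))

  -- In terms of generating functions, (1 + x)^q ≡ 1 + x^q modulo p, so this factor leaves the
  -- coefficients of (1 + x)^n below degree q unchanged.
  [n+q]Ck-< : ∀ n k → k < q → + ((n ℕ.+ q) C k) ≋ + (n C k)
  [n+q]Ck-< n       zero    _   = ≋-refl
  [n+q]Ck-< zero    (suc k) k<q = ≋-trans (qCk≋0 k k<q) (≋-reflexive (cong +_ (sym (k>n⇒nCk≡0 {0} {suc k} z<s))))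
  [n+q]Ck-< (suc n) (suc k) k<q = begin
    + (suc (n ℕ.+ q) C suc k)                  ≡⟨ +-pascal (n ℕ.+ q) k ⟩
    + ((n ℕ.+ q) C k) + + ((n ℕ.+ q) C suc k)  ≈⟨ +-cong ([n+q]Ck-< n k (ℕ.<⇒≤ k<q)) ([n+q]Ck-< n (suc k) k<q) ⟩
    + (n C k) + + (n C suc k)                  ≡⟨ +-pascal n k ⟨
    + (suc n C suc k)                          ∎

  -- The coefficient of x^(k + q) in (1 + x)^n (1 + x^q). Shifting the index up by q avoids
  -- subtraction.
  [n+q]C[k+q] : ∀ n k → + ((n ℕ.+ q) C (k ℕ.+ q)) ≋ + (n C (k ℕ.+ q)) + + (n C k)
  [n+q]C[k+q] zero zero = ≋-reflexive (cong +_
    (trans (nCn≡1 q) (cong (ℕ._+ 1) (sym (k>n⇒nCk≡0 {0} {q} z<s)))))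
  [n+q]C[k+q] zero (suc k) = ≋-reflexive (cong +_ (trans
    (k>n⇒nCk≡0 {q} {suc k ℕ.+ q} (s≤s (ℕ.m≤n+m q k)))
    (sym (cong₂ ℕ._+_ (k>n⇒nCk≡0 {0} {suc k ℕ.+ q} z<s) (k>n⇒nCk≡0 {0} {suc k} z<s)))))
  -- Pascal's rule lowers the index to `Q` = q - 1 here, so `[n+q]Ck-<` stands in for one induction
  -- hypothesis.
  [n+q]C[k+q] (suc n) zero = begin
    + (suc (n ℕ.+ q) C q)                         ≡⟨ +-pascal (n ℕ.+ q) Q ⟩
    + ((n ℕ.+ q) C Q) + + ((n ℕ.+ q) C q)         ≈⟨ +-cong ([n+q]Ck-< n Q ℕ.≤-refl) ([n+q]C[k+q] n zero) ⟩
    + (n C Q) + (+ (n C q) + + (n C 0))           ≡⟨ ℤ.+-assoc (+ (n C Q)) (+ (n C q)) (+ (n C 0)) ⟨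
    (+ (n C Q) + + (n C q)) + + (n C 0)           ≡⟨ cong (_+ 1ℤ) (+-pascal n Q) ⟨
    + (suc n C q) + + (suc n C 0)                 ∎
  [n+q]C[k+q] (suc n) (suc k) = begin
    + (suc (n ℕ.+ q) C suc (k ℕ.+ q))
      ≡⟨ +-pascal (n ℕ.+ q) (k ℕ.+ q) ⟩
    + ((n ℕ.+ q) C (k ℕ.+ q)) + + ((n ℕ.+ q) C (suc k ℕ.+ q))
      ≈⟨ +-cong ([n+q]C[k+q] n k) ([n+q]C[k+q] n (suc k)) ⟩
    (+ (n C (k ℕ.+ q)) + + (n C k)) + (+ (n C (suc k ℕ.+ q)) + + (n C suc k))
      ≡⟨ interchange (+ (n C (k ℕ.+ q))) (+ (n C k)) (+ (n C (suc k ℕ.+ q))) (+ (n C suc k)) ⟩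
    (+ (n C (k ℕ.+ q)) + + (n C (suc k ℕ.+ q))) + (+ (n C k) + + (n C suc k))
      ≡⟨ cong₂ _+_ (+-pascal n (k ℕ.+ q)) (+-pascal n k) ⟨
    + (suc n C (suc k ℕ.+ q)) + + (suc n C suc k) ∎
    where
    interchange : ∀ a b c d → (a + b) + (c + d) ≡ (a + c) + (b + d)
    interchange = solve-∀

  suc-digit : ∀ n a → suc n ℕ.* q ℕ.+ a ≡ (n ℕ.* q ℕ.+ a) ℕ.+ q
  suc-digit n a = trans (ℕ.+-assoc q (n ℕ.* q) a) (ℕ.+-comm q (n ℕ.* q ℕ.+ a))

  -- Taking q off the upper index lowers `n` by one, and `[n+q]C[k+q]` then acts as Pascal's rule on
  -- the quotients `n` and `m`, while the remainders `a` and `r` stay fixed.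
  lucas : ∀ n m {a r} → a < q → r < q →
          + ((n ℕ.* q ℕ.+ a) C (m ℕ.* q ℕ.+ r)) ≋ + (n C m) * + (a C r)
  lucas zero zero {a} {r} _ _ = ≋-reflexive (sym (ℤ.*-identityˡ (+ (a C r))))
  lucas zero (suc m) {a} {r} a<q _ = ≋-reflexive (trans
    (cong +_ (k>n⇒nCk≡0 {a} {suc m ℕ.* q ℕ.+ r} (ℕ.<-≤-trans a<q
      (ℕ.≤-trans (ℕ.m≤m+n q (m ℕ.* q)) (ℕ.m≤m+n (suc m ℕ.* q) r)))))
    (cong (λ z → + z * + (a C r)) (sym (k>n⇒nCk≡0 {0} {suc m} z<s))))
  lucas (suc n) zero {a} {r} a<q r<q = begin
    + ((suc n ℕ.* q ℕ.+ a) C r)       ≡⟨ cong (λ z → + (z C r)) (suc-digit n a) ⟩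
    + ((n ℕ.* q ℕ.+ a ℕ.+ q) C r)     ≈⟨ [n+q]Ck-< (n ℕ.* q ℕ.+ a) r r<q ⟩
    + ((n ℕ.* q ℕ.+ a) C r)           ≈⟨ lucas n zero a<q r<q ⟩
    + (suc n C 0) * + (a C r)         ∎
  lucas (suc n) (suc m) {a} {r} a<q r<q = begin
    + ((suc n ℕ.* q ℕ.+ a) C (suc m ℕ.* q ℕ.+ r))
      ≡⟨ cong₂ (λ y z → + (y C z)) (suc-digit n a) (suc-digit m r) ⟩
    + ((n ℕ.* q ℕ.+ a ℕ.+ q) C (m ℕ.* q ℕ.+ r ℕ.+ q))
      ≈⟨ [n+q]C[k+q] (n ℕ.* q ℕ.+ a) (m ℕ.* q ℕ.+ r) ⟩
    + ((n ℕ.* q ℕ.+ a) C (m ℕ.* q ℕ.+ r ℕ.+ q)) + + ((n ℕ.* q ℕ.+ a) C (m ℕ.* q ℕ.+ r))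
      ≡⟨ cong (λ z → + ((n ℕ.* q ℕ.+ a) C z) + + ((n ℕ.* q ℕ.+ a) C (m ℕ.* q ℕ.+ r))) (suc-digit m r) ⟨
    + ((n ℕ.* q ℕ.+ a) C (suc m ℕ.* q ℕ.+ r)) + + ((n ℕ.* q ℕ.+ a) C (m ℕ.* q ℕ.+ r))
      ≈⟨ +-cong (lucas n (suc m) a<q r<q) (lucas n m a<q r<q) ⟩
    + (n C suc m) * + (a C r) + + (n C m) * + (a C r)
      ≡⟨ factor (+ (n C suc m)) (+ (n C m)) (+ (a C r)) ⟩
    (+ (n C m) + + (n C suc m)) * + (a C r)
      ≡⟨ cong (_* + (a C r)) (+-pascal n m) ⟨
    + (suc n C suc m) * + (a C r) ∎
    where
    factor : ∀ x y c → x * c + y * c ≡ (y + x) * c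
    factor = solve-∀

  -- Neighbours in row q - 1 sum to an inner entry of row q, which vanishes modulo p. So the row
  -- alternates in sign, starting from 1.
  [q-1]Ck≋±1 : ∀ k → k < q → + (Q C k) ≋ -1ℤ ^ k
  [q-1]Ck≋±1 zero    _   = ≋-refl
  [q-1]Ck≋±1 (suc k) k<q = begin
    + (Q C suc k)                              ≡⟨ isolate (+ (Q C k)) (+ (Q C suc k)) ⟩
    (+ (Q C k) + + (Q C suc k)) + -1ℤ * + (Q C k) ≡⟨ cong (_+ -1ℤ * + (Q C k)) (+-pascal Q k) ⟨
    + (q C suc k) + -1ℤ * + (Q C k)
      ≈⟨ +-cong (qCk≋0 k k<q) (*-congˡ -1ℤ ([q-1]Ck≋±1 k (ℕ.<⇒≤ k<q))) ⟩
    0ℤ + -1ℤ ^ suc k                           ≡⟨ ℤ.+-identityˡ _ ⟩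
    -1ℤ ^ suc k                                ∎
    where
    isolate : ∀ x y → y ≡ (x + y) + -1ℤ * x
    isolate = solve-∀

  -- The upper index is (n + 1) q - 1, whose remainder modulo q is q - 1. It is written as
  -- `suc n * q` computes once its outer successor is removed.
  lucas-top : ∀ n m {r} → r < q → + ((Q ℕ.+ n ℕ.* q) C (m ℕ.* q ℕ.+ r)) ≋ + (n C m) * -1ℤ ^ r
  lucas-top n m {r} r<q = begin
    + ((Q ℕ.+ n ℕ.* q) C (m ℕ.* q ℕ.+ r))  ≡⟨ cong (λ z → + (z C (m ℕ.* q ℕ.+ r))) (ℕ.+-comm Q (n ℕ.* q)) ⟩
    + ((n ℕ.* q ℕ.+ Q) C (m ℕ.* q ℕ.+ r))  ≈⟨ lucas n m ℕ.≤-refl r<q ⟩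
    + (n C m) * + (Q C r)                  ≈⟨ *-congˡ (+ (n C m)) ([q-1]Ck≋±1 r r<q) ⟩
    + (n C m) * -1ℤ ^ r                    ∎

-- The binomial modulo p q.

absorption-base : ∀ n m Q r →
  (m ℕ.* suc Q ℕ.+ suc r) ℕ.* ((suc n ℕ.* suc Q) C (m ℕ.* suc Q ℕ.+ suc r)) ≡
  (suc n ℕ.* suc Q) ℕ.* ((Q ℕ.+ n ℕ.* suc Q) C (m ℕ.* suc Q ℕ.+ r))
absorption-base n m Q r rewrite ℕ.+-suc (m ℕ.* suc Q) r =
  absorption (Q ℕ.+ n ℕ.* suc Q) (m ℕ.* suc Q ℕ.+ r)

-- By absorption q divides k * C(N , k), where k = m q + (r + 1). As p divides q but not r + 1, it
-- does not divide k, so the power of p passes to the binomial.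
q∣binomial : ∀ {p} s n m Q {r} → Prime p → p ℕ.^ s ≡ suc Q → p ℕ∣.∣ suc Q → p ∤ suc r →
             suc Q ℕ∣.∣ ((suc n ℕ.* suc Q) C (m ℕ.* suc Q ℕ.+ suc r))
q∣binomial {p} s n m Q {r} pr eq p∣q p∤r =
  subst (ℕ∣._∣ _) eq (p^s∣m*n⇒p^s∣n s pr p∤k (subst₂ ℕ∣._∣_ (sym eq) (sym (absorption-base n m Q r)) q∣))
  where
  p∤k : p ∤ (m ℕ.* suc Q ℕ.+ suc r)
  p∤k p∣k = p∤r (ℕ∣.∣m+n∣m⇒∣n p∣k (ℕ∣.∣n⇒∣m*n m p∣q))
  q∣ = ℕ∣.∣m⇒∣m*n ((Q ℕ.+ n ℕ.* suc Q) C (m ℕ.* suc Q ℕ.+ r)) (ℕ∣.n∣m*n (suc n) {suc Q})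

-- By q∣binomial, the theorem is q times this congruence modulo p.
module _ {p : ℕ} (s : ℕ) {Q r : ℕ} (pr : Prime p) (p^s≡q : p ℕ.^ s ≡ suc Q) (p∣q : p ℕ∣.∣ suc Q)
         (r<q : suc r < suc Q) (r′ : ℤ) (inverse : (+ suc r) * r′ ≡ 1ℤ [mod + p ]) where

  private
    q = suc Q

    p∣qCk : ∀ k → suc k < q → p ℕ∣.∣ (q C suc k)
    p∣qCk k = subst (λ z → suc k < z → p ℕ∣.∣ (z C suc k)) p^s≡q (p∣p^sCk s pr)

  open Congruence (+ p)
  open SetoidReasoning ≋-setoid
  open Lucas p Q p∣qCk using (lucas-top)

  binomial/q≋ : ∀ n m w → (suc n ℕ.* q) C (m ℕ.* q ℕ.+ suc r) ≡ w ℕ.* q →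
                + w ≋ -1ℤ ^ r * r′ * + suc m * + (suc n C suc m)
  binomial/q≋ n m w c≡wq = begin
    + w
      ≡⟨ ℤ.*-identityʳ (+ w) ⟨
    + w * 1ℤ
      ≈⟨ *-congˡ (+ w) (≋-sym (mod inverse)) ⟩
    + w * (+ suc r * r′)
      -- The term `m * 0` is planted so that 0 ≡ q can turn `suc r` into the full lower index `k`,
      -- making absorption applicable.
      ≡⟨ pad (+ w) (+ suc r) r′ (+ m) ⟩
    + w * r′ * (+ m * 0ℤ + + suc r)
      ≈⟨ *-congˡ (+ w * r′) (+-cong (*-congˡ (+ m) (≋-sym (∣⇒≋0 (ℤ∣.∣ᵤ⇒∣ p∣q)))) ≋-refl) ⟩
    + w * r′ * (+ m * + q + + suc r)
      ≡⟨ cong (λ z → + w * r′ * (z + + suc r)) (ℤ.pos-* m q) ⟨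
    + w * r′ * + k
      ≡⟨ regroup (+ w) r′ (+ k) ⟩
    r′ * (+ k * + w)
      ≡⟨ cong (r′ *_) (ℤ.pos-* k w) ⟨
    r′ * + (k ℕ.* w)
      ≡⟨ cong (λ z → r′ * + z) kw≡[1+n]b ⟩
    r′ * + (suc n ℕ.* b)
      ≡⟨ cong (r′ *_) (ℤ.pos-* (suc n) b) ⟩
    r′ * (+ suc n * + b)
      ≈⟨ *-congˡ r′ (*-congˡ (+ suc n) (lucas-top n m (ℕ.<⇒≤ r<q))) ⟩
    r′ * (+ suc n * (+ (n C m) * -1ℤ ^ r))
      ≡⟨ reorder r′ (+ suc n) (+ (n C m)) (-1ℤ ^ r) ⟩
    -1ℤ ^ r * r′ * (+ suc n * + (n C m))
      ≡⟨ cong (-1ℤ ^ r * r′ *_) (ℤ.pos-* (suc n) (n C m)) ⟨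
    -1ℤ ^ r * r′ * + (suc n ℕ.* (n C m))
      ≡⟨ cong (λ z → -1ℤ ^ r * r′ * + z) (absorption n m) ⟨
    -1ℤ ^ r * r′ * + (suc m ℕ.* (suc n C suc m))
      ≡⟨ cong (-1ℤ ^ r * r′ *_) (ℤ.pos-* (suc m) (suc n C suc m)) ⟩
    -1ℤ ^ r * r′ * (+ suc m * + (suc n C suc m))
      ≡⟨ ℤ.*-assoc (-1ℤ ^ r * r′) (+ suc m) (+ (suc n C suc m)) ⟨
    -1ℤ ^ r * r′ * + suc m * + (suc n C suc m) ∎
    where
    k = m ℕ.* q ℕ.+ suc r
    b = (Q ℕ.+ n ℕ.* q) C (m ℕ.* q ℕ.+ r)
    swap : ∀ x y z → x ℕ.* y ℕ.* z ≡ x ℕ.* z ℕ.* y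
    swap = ℕSolver.solve-∀
    kw≡[1+n]b : k ℕ.* w ≡ suc n ℕ.* b
    -- The factor q is cancelled in an exact equation of naturals, before any reduction modulo p.
    kw≡[1+n]b = ℕ.*-cancelʳ-≡ (k ℕ.* w) (suc n ℕ.* b) q (trans (ℕ.*-assoc k w q)
      (trans (cong (k ℕ.*_) (sym c≡wq)) (trans (absorption-base n m Q r) (swap (suc n) q b))))
    pad : ∀ w a a′ m → w * (a * a′) ≡ w * a′ * (m * 0ℤ + a)
    pad = solve-∀
    regroup : ∀ w a k → w * a * k ≡ a * (k * w)
    regroup = solve-∀
    reorder : ∀ a n d x → a * (n * (d * x)) ≡ x * a * (n * d)
    reorder = solve-∀

-- The power p ^ s is abstracted to `q` so that it can be matched as a successor.
binomial-congruence : ∀ {p} n m s q r → Prime p → p ℕ.^ s ≡ q → p ℕ∣.∣ q → suc r < q → p ∤ suc r →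
  (r′ : ℤ) → (+ suc r) * r′ ≡ 1ℤ [mod + p ] →
  + ((n ℕ.* q) C (m ℕ.* q ℕ.+ suc r))
    ≡ -1ℤ ^ r * r′ * + suc m * + (n C suc m) * + q [mod + (p ℕ.* q) ]
-- With n = 0 there is no N - 1 for absorption; both binomials vanish, their lower indices being
-- positive.
binomial-congruence {p} zero m s q r _ _ _ _ _ r′ _ =
  Congruence.unmod (Congruence.≋-reflexive (+ (p ℕ.* q)) (begin
    + (0 C (m ℕ.* q ℕ.+ suc r))      ≡⟨ cong +_ (k>n⇒nCk≡0 {0} {m ℕ.* q ℕ.+ suc r} 0<k) ⟩
    0ℤ                               ≡⟨ cong (_* + q) (ℤ.*-zeroʳ u) ⟨
    u * 0ℤ * + q                     ≡⟨ cong (λ z → u * + z * + q) (k>n⇒nCk≡0 {0} {suc m} z<s) ⟨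
    u * + (0 C suc m) * + q          ∎))
  where
  open ≡-Reasoning
  u = -1ℤ ^ r * r′ * + suc m
  0<k : 0 < m ℕ.* q ℕ.+ suc r
  0<k = ℕ.<-≤-trans z<s (ℕ.m≤n+m (suc r) (m ℕ.* q))
binomial-congruence {p} (suc n) m s (suc Q) r pr p^s≡q p∣q r<q p∤r r′ inverse
  with ℕ∣.divides w c≡wq ← q∣binomial s n m Q pr p^s≡q p∣q p∤r =
  subst₂ (λ c k → c ≡ -1ℤ ^ r * r′ * + suc m * + (suc n C suc m) * + q [mod k ])
    (trans (sym (ℤ.pos-* w q)) (cong +_ (sym c≡wq))) (sym (ℤ.pos-* p q))
    (*-mono-mod (+ q) (binomial/q≋ s pr p^s≡q p∣q r<q r′ inverse n m w c≡wq))
  where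
  q = suc Q

theorem1p1 : (p n m s r : ℕ) → Prime p → n ≥ m → s ≥ 1 → 1 ≤ r → r ≤ p ℕ.^ s ∸ 1 → p ∤ r →
    (r′ : ℤ) → (+ r) * r′ ≡ 1ℤ [mod + p ] →
    + ((n ℕ.* p ℕ.^ s) C (m ℕ.* p ℕ.^ s ℕ.+ r))
    ≡ (-1ℤ ^ (r ∸ 1)) * r′ * (+ (m ℕ.+ 1)) * (+ (n C (m ℕ.+ 1))) * (+ (p ℕ.^ s))
    [mod + (p ℕ.^ (s ℕ.+ 1)) ]
theorem1p1 p n m s@(suc s-1) (suc r) pr _ _ _ r≤q-1 p∤r r′ inverse
  -- Now m + 1 reads `suc m`, and p ^ (s + 1) computes to the modulus p * p ^ s.
  rewrite ℕ.+-comm m 1 | ℕ.+-comm s-1 1 =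
  binomial-congruence n m s (p ℕ.^ s) r pr refl (ℕ∣.m∣m*n (p ℕ.^ s-1)) r<q p∤r r′ inverse
  where
  instance _ = prime⇒nonZero pr
  r<q : suc r < p ℕ.^ s
  -- Positivity of p ^ s makes the truncated difference `p ^ s ∸ 1` strictly smaller than p ^ s.
  r<q = ℕ.≤-<-trans r≤q-1 (ℕ.∸-monoʳ-< {p ℕ.^ s} z<s (ℕ.m^n>0 p s))
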